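{- Let $n\ge1$. The Voronoi cell $V(\mathbf 0)$ of the lattice $A_n$ is the projection of the unit cube $[0,1]^{n+1}$ via $\Xi$, i.e. $$V(\mathbf 0)=\Xi\,[0,1]^{n+1}.$$
   Context: Let $\mathbf 1=(1,\dots,1)^T\in\mathbb R^{n+1}$ and $H=\{x\in\mathbb R^{n+1}:x\cdot\mathbf 1=0\}$. The lattice $A_n$ is $\mathbb Z^{n+1}\cap H$. Its Voronoi cell at the origin, taken inside $H$, is $V(\mathbf 0)=\{x\in H:\|x\|\le\|x-q\|\text{ for all }q\in A_n\}$. The matrix $\Xi=I_{n+1}-\frac1{n+1}\mathbf 1\mathbf 1^T$ is the orthogonal projection of $\mathbb R^{n+1}$ onto $H$ along $\mathbf 1$. -}

module Defs where

open import Level using (suc; _⊔_)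
open import Data.Nat.Base as ℕ using (ℕ)
open import Data.Integer.Base using (ℤ; +_; -[1+_])
open import Data.Fin.Properties using (_≟_)
open import Data.Bool.Base using (if_then_else_)
open import Data.Product.Base using (∃; _×_; _,_; proj₁)
open import Data.Sum.Base using (_⊎_; inj₂)
open import Data.Vec.Functional using (Vector; replicate; zipWith; map)
open import Data.Vec.Functional.Relation.Binary.Pointwise using (Pointwise)
open import Function.Bundles using (_⇔_; Equivalence)
open import Relation.Binary.Core using (Rel)
open import Relation.Binary.Structures using (IsStrictPartialOrder)
open import Relation.Binary.Lattice.Structures using (IsLattice)
open import Relation.Nullary.Decidable using (does)
open import Relation.Nullary.Negation using (¬_)
open import Relation.Unary using (Pred; _∈_; _∩_)
open import Algebra.Core using (Op₁; Op₂)
open import Algebra.Apartness.Bundles using (HeytingField)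
open import Algebra.Bundles using (CommutativeRing)
import Algebra.Properties.Semiring.Sum as SemiringSum
import Algebra.Definitions.RawMonoid as RawMonoidDefinitions

-- Ordered fields in the constructive form of the HoTT book (Definition 11.2.7):
-- no order is assumed decidable, x ≤ y is ¬ (y < x), and binary joins and meets
-- are part of the structure.
record OrderedField c ℓ₁ ℓ₂ : Set (suc (c ⊔ ℓ₁ ⊔ ℓ₂)) where
  infix  4 _<_ _≤_
  infixr 6 _∨_
  infixr 7 _∧_
  field
    heytingField : HeytingField c ℓ₁ ℓ₂

  open HeytingField heytingField public

  field
    _<_                    : Rel Carrier ℓ₂
    <-isStrictPartialOrder : IsStrictPartialOrder _≈_ _<_
    #⇔<⊎>                  : ∀ {x y} → x # y ⇔ (x < y ⊎ y < x)
    0<1                    : 0# < 1#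
    +-monoˡ-<              : ∀ z {x y} → x < y → x + z < y + z
    *-pos                  : ∀ {x y} → 0# < x → 0# < y → 0# < x * y

  _≤_ : Rel Carrier ℓ₂
  x ≤ y = ¬ (y < x)

  field
    _∨_ _∧_   : Op₂ Carrier
    isLattice : IsLattice _≈_ _≤_ _∨_ _∧_

  open IsStrictPartialOrder <-isStrictPartialOrder public
    using (<-respˡ-≈; <-respʳ-≈)
    renaming (irrefl to <-irrefl; trans to <-trans)

  commutativeRing : CommutativeRing c ℓ₁
  commutativeRing = record { isCommutativeRing = isCommutativeRing }

  open CommutativeRing commutativeRing public
    using (semiring; +-rawMonoid)

  open RawMonoidDefinitions +-rawMonoid
    using () renaming (_×_ to _times_)

  ∣_∣ : Op₁ Carrier
  ∣ x ∣ = x ∨ (- x)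

  fromℕ : ℕ → Carrier
  fromℕ n = n times 1#

  fromℤ : ℤ → Carrier
  fromℤ (+ n)    = fromℕ n
  fromℤ -[1+ n ] = - fromℕ (ℕ.suc n)

  0<fromℕ-suc : ∀ n → 0# < fromℕ (ℕ.suc n)
  0<fromℕ-suc ℕ.zero    = <-respʳ-≈ (sym (+-identityʳ 1#)) 0<1
  0<fromℕ-suc (ℕ.suc n) =
    <-trans 0<1
      (<-respˡ-≈ (+-identityˡ 1#)
        (<-respʳ-≈ (+-comm _ 1#) (+-monoˡ-< 1# (0<fromℕ-suc n))))

  -- The stdlib states invertibility for a difference, so this is the inverse
  -- of x - 0#.
  reciprocal : ∀ x → x # 0# → Carrier
  reciprocal x x#0 = proj₁ (#⇒invertible x#0)

  1/suc : ℕ → Carrier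
  1/suc n = reciprocal (fromℕ (ℕ.suc n))
                       (Equivalence.from #⇔<⊎> (inj₂ (0<fromℕ-suc n)))

  IsCauchy : Pred (ℕ → Carrier) (c ⊔ ℓ₂)
  IsCauchy s = ∀ ε → 0# < ε →
    ∃ λ N → ∀ m n → N ℕ.≤ m → N ℕ.≤ n → ∣ s m - s n ∣ < ε

  _ConvergesTo_ : (ℕ → Carrier) → Carrier → Set (c ⊔ ℓ₂)
  s ConvergesTo l = ∀ ε → 0# < ε →
    ∃ λ N → ∀ n → N ℕ.≤ n → ∣ s n - l ∣ < ε

-- The real numbers as a Cauchy complete Archimedean ordered field, which is
-- unique up to isomorphism.  Square roots of nonnegative elements exist uniquely
-- by completeness; naming them in the record does not restrict the models.
-- The value of √ at negative arguments is unspecified.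
record RealNumbers c ℓ₁ ℓ₂ : Set (suc (c ⊔ ℓ₁ ⊔ ℓ₂)) where
  field
    orderedField : OrderedField c ℓ₁ ℓ₂

  open OrderedField orderedField public

  field
    archimedean : ∀ x → ∃ λ n → x < fromℕ n
    complete    : ∀ s → IsCauchy s → ∃ λ l → s ConvergesTo l
    √           : Op₁ Carrier
    √-nonNeg    : ∀ {x} → 0# ≤ x → 0# ≤ √ x
    √-square    : ∀ {x} → 0# ≤ x → √ x * √ x ≈ x

module Euclidean {c ℓ₁ ℓ₂} (ℝ : RealNumbers c ℓ₁ ℓ₂) where

  open RealNumbers ℝ
  open SemiringSum semiring using (sum)

  infix  4 _≋_
  infixl 7 _·_
  infixl 7 _*ᵥ_
  infixl 6 _-ᵥ_

  ℝ^ : ℕ → Set c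
  ℝ^ = Vector Carrier

  Matrix : ℕ → ℕ → Set c
  Matrix m n = Vector (ℝ^ n) m

  _≋_ : ∀ {n} → Rel (ℝ^ n) ℓ₁
  _≋_ = Pointwise _≈_

  _-ᵥ_ : ∀ {n} → ℝ^ n → ℝ^ n → ℝ^ n
  _-ᵥ_ = zipWith _-_

  _·_ : ∀ {n} → ℝ^ n → ℝ^ n → Carrier
  x · y = sum (zipWith _*_ x y)

  ∥_∥ : ∀ {n} → ℝ^ n → Carrier
  ∥ x ∥ = √ (x · x)

  _*ᵥ_ : ∀ {m n} → Matrix m n → ℝ^ n → ℝ^ m
  (M *ᵥ x) i = M i · x

  image : ∀ {m n ℓ} → Matrix m n → Pred (ℝ^ n) ℓ → Pred (ℝ^ m) (c ⊔ ℓ₁ ⊔ ℓ)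
  image M S x = ∃ λ y → y ∈ S × x ≋ M *ᵥ y

  𝟏 : ∀ {n} → ℝ^ n
  𝟏 = replicate _ 1#

  identity : ∀ n → Matrix n n
  identity n i j = if does (i ≟ j) then 1# else 0#

  outer : ∀ {m n} → ℝ^ m → ℝ^ n → Matrix m n
  outer x y i j = x i * y j

  ℤ^ : ∀ n → Pred (ℝ^ n) ℓ₁
  ℤ^ n q = ∃ λ (z : Vector ℤ n) → q ≋ map fromℤ z

  UnitCube : ∀ n → Pred (ℝ^ n) ℓ₂
  UnitCube n y = ∀ i → 0# ≤ y i × y i ≤ 1#

  H : ∀ n → Pred (ℝ^ (ℕ.suc n)) ℓ₁
  H n x = x · 𝟏 ≈ 0#

  A : ∀ n → Pred (ℝ^ (ℕ.suc n)) ℓ₁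
  A n = ℤ^ (ℕ.suc n) ∩ H n

  VoronoiCell : ∀ n → Pred (ℝ^ (ℕ.suc n)) (c ⊔ ℓ₁ ⊔ ℓ₂)
  VoronoiCell n x = x ∈ H n × (∀ q → q ∈ A n → ∥ x ∥ ≤ ∥ x -ᵥ q ∥)

  Ξ : ∀ n → Matrix (ℕ.suc n) (ℕ.suc n)
  Ξ n i j = identity (ℕ.suc n) i j - 1/suc n * outer 𝟏 𝟏 i j

{-# OPTIONS --safe #-}

-- Since ‖x − q‖² = ‖x‖² − 2 x·q + ‖q‖², a point x of H lies in the Voronoi cell
-- iff 2 x·q ≤ q·q for all q in A_n.
--
-- If x is in the cell, the lattice vectors eᵢ − eⱼ give xᵢ − xⱼ ≤ 1.  Subtracting
-- the least coordinate of x from all coordinates then yields a point of the cube,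
-- and Ξ maps it back to x because Ξ kills multiples of 𝟏.
--
-- Conversely, for x = Ξ y with y in the cube, x·q = y·q, and as Σ qᵢ = 0 it is
-- enough to show 2 yᵢ qᵢ ≤ qᵢ² + qᵢ, which holds for integers qᵢ and 0 ≤ yᵢ ≤ 1.
module Submission where

open import Defs
open import Data.Nat.Base using (ℕ; zero; suc; _≥_)
open import Data.Integer.Base as ℤ using (ℤ; +_; -[1+_])
open import Data.Bool.Base using (Bool; true; false; if_then_else_)
open import Data.Fin.Base using (Fin; zero; suc)
open import Data.Fin.Properties using (_≟_)
open import Data.Product.Base using (_,_; proj₁; proj₂)
open import Data.Sum.Base using (_⊎_; inj₁; inj₂)
open import Data.Vec.Functional using (Vector; head; tail; foldr; replicate; zipWith)
open import Function.Base using (_∘_)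
open import Function.Bundles using (Equivalence)
open import Relation.Binary.Bundles using (Poset)
open import Relation.Binary.Lattice.Structures using (IsLattice)
open import Relation.Nullary.Decidable using (does)
open import Relation.Nullary.Negation using (¬_; contradiction)
open import Relation.Unary using (_≐_; _∈_)
open import Algebra.Bundles using (CommutativeRing)
import Algebra.Properties.Ring as RingProperties
import Algebra.Properties.Semiring.Sum as SemiringSum
import Algebra.Apartness.Properties.HeytingCommutativeRing as HeytingProperties
import Algebra.Solver.Ring.NaturalCoefficients.Default as SemiringSolver
import Relation.Binary.Reasoning.PartialOrder as PartialOrderReasoning
import Relation.Binary.Reasoning.Setoid as SetoidReasoning

-- Inequalities in an ordered field whose order is not assumed decidable.

module OrderedFieldProperties {c ℓ₁ ℓ₂} (F : OrderedField c ℓ₁ ℓ₂) where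

  open OrderedField F hiding (zero)
  open CommutativeRing commutativeRing public using (ring; commutativeSemiring)
  open RingProperties ring public
  open HeytingProperties heytingCommutativeRing using (x-0≈x)
  open SemiringSum semiring using (sum)
  open IsLattice isLattice public
    using (isPartialOrder; x∧y≤x; x∧y≤y; ∧-greatest)
    renaming (refl to ≤-refl; reflexive to ≤-reflexive; trans to ≤-trans)

  poset : Poset c ℓ₁ ℓ₂
  poset = record { isPartialOrder = isPartialOrder }

  module ≤-Reasoning = PartialOrderReasoning poset
  module ≈-Reasoning = SetoidReasoning setoid

  <⇒≤ : ∀ {x y} → x < y → x ≤ y
  <⇒≤ x<y y<x = <-irrefl refl (<-trans x<y y<x)

  -- `x ≤ y` is only a negation and cannot be chained with `y < z` directly. Cotransitivity makes
  -- `x` apart from `y` or from `z`, and `x ≤ y` excludes the wrong side in each case.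
  ≤-<-trans : ∀ {x y z} → x ≤ y → y < z → x < z
  ≤-<-trans {x} {y} {z} x≤y y<z
    with #-cotrans (Equivalence.from #⇔<⊎> (inj₁ y<z)) x
  ... | inj₁ y#x with Equivalence.to #⇔<⊎> y#x
  ...   | inj₁ y<x = contradiction y<x x≤y
  ...   | inj₂ x<y = <-trans x<y y<z
  ≤-<-trans {x} {y} {z} x≤y y<z | inj₂ x#z with Equivalence.to #⇔<⊎> x#z
  ...   | inj₁ x<z = x<z
  ...   | inj₂ z<x = contradiction (<-trans y<z z<x) x≤y

  +-monoˡ-≤ : ∀ z {x y} → x ≤ y → x + z ≤ y + z
  +-monoˡ-≤ z {x} {y} x≤y y+z<x+z = x≤y
    (<-respˡ-≈ (//-rightDividesʳ z y)
      (<-respʳ-≈ (//-rightDividesʳ z x) (+-monoˡ-< (- z) y+z<x+z)))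

  +-mono-≤ : ∀ {x y u v} → x ≤ y → u ≤ v → x + u ≤ y + v
  +-mono-≤ {x} {y} {u} {v} x≤y u≤v = begin
    x + u  ≤⟨ +-monoˡ-≤ u x≤y ⟩
    y + u  ≈⟨ +-comm y u ⟩
    u + y  ≤⟨ +-monoˡ-≤ y u≤v ⟩
    v + y  ≈⟨ +-comm v y ⟩
    y + v  ∎
    where open ≤-Reasoning

  +-cancelʳ-≤ : ∀ z {x y} → x + z ≤ y + z → x ≤ y
  +-cancelʳ-≤ z x+z≤y+z y<x = x+z≤y+z (+-monoˡ-< z y<x)

  x≤y⇒0≤y-x : ∀ {x y} → x ≤ y → 0# ≤ y - x
  x≤y⇒0≤y-x {x} {y} x≤y = begin
    0#     ≈⟨ -‿inverseʳ x ⟨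
    x - x  ≤⟨ +-monoˡ-≤ (- x) x≤y ⟩
    y - x  ∎
    where open ≤-Reasoning

  x-z≤y⇒x-y≤z : ∀ {x y z} → x - z ≤ y → x - y ≤ z
  x-z≤y⇒x-y≤z {x} {y} {z} x-z≤y = +-cancelʳ-≤ y (begin
    x - y + y  ≈⟨ //-rightDividesˡ y x ⟩
    x          ≈⟨ //-rightDividesˡ z x ⟨
    x - z + z  ≤⟨ +-monoˡ-≤ z x-z≤y ⟩
    y + z      ≈⟨ +-comm y z ⟩
    z + y      ∎)
    where open ≤-Reasoning

  neg-antitone-≤ : ∀ {x y} → x ≤ y → - y ≤ - x
  neg-antitone-≤ {x} {y} x≤y = +-cancelʳ-≤ y (begin
    - y + y  ≈⟨ -‿inverseˡ y ⟩
    0#       ≤⟨ x≤y⇒0≤y-x x≤y ⟩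
    y - x    ≈⟨ +-comm y (- x) ⟩
    - x + y  ∎)
    where open ≤-Reasoning

  -- From `y < x` follows y + y < x + y < x + x. This replaces division by 2.
  x+x≤y+y⇒x≤y : ∀ {x y} → x + x ≤ y + y → x ≤ y
  x+x≤y+y⇒x≤y {x} {y} x+x≤y+y y<x = x+x≤y+y
    (<-trans (+-monoˡ-< y y<x)
      (<-respˡ-≈ (+-comm y x) (+-monoˡ-< x y<x)))

  *-monoʳ-< : ∀ {a x y} → 0# < a → x < y → x * a < y * a
  *-monoʳ-< {a} {x} {y} 0<a x<y =
    <-respˡ-≈ (+-identityˡ (x * a))
      (<-respʳ-≈ (trans (+-congʳ ([y-z]x≈yx-zx a y x)) (//-rightDividesˡ (x * a) (y * a)))
        (+-monoˡ-< (x * a)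
          (*-pos (<-respˡ-≈ (-‿inverseʳ x) (+-monoˡ-< (- x) x<y)) 0<a)))

  -- Although the order is not decidable, a failure of either factor to be apart
  -- from 0 makes the product 0, so both may be assumed apart from 0 when
  -- refuting x * y < 0.
  *-nonNeg : ∀ {x y} → 0# ≤ x → 0# ≤ y → 0# ≤ x * y
  *-nonNeg {x} {y} 0≤x 0≤y xy<0 =
    xy≉0 (trans (*-congʳ (proj₁ (tight x 0#) λ x#0 →
      xy≉0 (trans (*-congˡ (proj₁ (tight y 0#) λ y#0 →
        <⇒≤ (*-pos (#∧≥⇒> x#0 0≤x) (#∧≥⇒> y#0 0≤y)) xy<0)) (zeroʳ x)))) (zeroˡ y))
    where
    xy≉0 : ¬ x * y ≈ 0#
    xy≉0 xy≈0 = <-irrefl xy≈0 xy<0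

    #∧≥⇒> : ∀ {z} → z # 0# → 0# ≤ z → 0# < z
    #∧≥⇒> z#0 0≤z with Equivalence.to #⇔<⊎> z#0
    ... | inj₁ z<0 = contradiction z<0 0≤z
    ... | inj₂ 0<z = 0<z

  *-monoʳ-≤ : ∀ {a x y} → 0# ≤ a → x ≤ y → x * a ≤ y * a
  *-monoʳ-≤ {a} {x} {y} 0≤a x≤y = begin
    x * a                    ≈⟨ +-identityˡ (x * a) ⟨
    0# + x * a               ≤⟨ +-monoˡ-≤ (x * a) (*-nonNeg (x≤y⇒0≤y-x x≤y) 0≤a) ⟩
    (y - x) * a + x * a      ≈⟨ +-congʳ ([y-z]x≈yx-zx a y x) ⟩
    y * a - x * a + x * a    ≈⟨ //-rightDividesˡ (x * a) (y * a) ⟩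
    y * a                    ∎
    where open ≤-Reasoning

  *-monoˡ-≤ : ∀ {a x y} → 0# ≤ a → x ≤ y → a * x ≤ a * y
  *-monoˡ-≤ {a} {x} {y} 0≤a x≤y = begin
    a * x  ≈⟨ *-comm a x ⟩
    x * a  ≤⟨ *-monoʳ-≤ 0≤a x≤y ⟩
    y * a  ≈⟨ *-comm y a ⟩
    a * y  ∎
    where open ≤-Reasoning

  square-mono-≤ : ∀ {x y} → 0# ≤ x → x ≤ y → x * x ≤ y * y
  square-mono-≤ 0≤x x≤y =
    ≤-trans (*-monoʳ-≤ 0≤x x≤y) (*-monoˡ-≤ (≤-trans 0≤x x≤y) x≤y)

  -- If `y < x`, then y * y ≤ y * x < x * x. The first step is weak because `y` may vanish; the
  -- second is strict because 0 ≤ y < x.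
  square-cancel-≤ : ∀ {x y} → 0# ≤ y → x * x ≤ y * y → x ≤ y
  square-cancel-≤ 0≤y xx≤yy y<x = xx≤yy
    (≤-<-trans (*-monoˡ-≤ 0≤y (<⇒≤ y<x)) (*-monoʳ-< (≤-<-trans 0≤y y<x) y<x))

  -x*-x≈x*x : ∀ x → - x * - x ≈ x * x
  -x*-x≈x*x x = begin
    - x * - x    ≈⟨ -‿distribʳ-* (- x) x ⟨
    - (- x * x)  ≈⟨ -‿cong (-‿distribˡ-* x x) ⟨
    - - (x * x)  ≈⟨ -‿involutive (x * x) ⟩
    x * x        ∎
    where open ≈-Reasoning

  -- If `x` is apart from 0 it has a sign, and `x * x` or `- x * - x` is a product of nonnegative
  -- factors. Otherwise tightness gives `x ≈ 0#`. Either way `x * x < 0#` is refuted.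
  square-nonNeg : ∀ x → 0# ≤ x * x
  square-nonNeg x xx<0 = x≉0 (proj₁ (tight x 0#) λ x#0 → x*x≮0 (Equivalence.to #⇔<⊎> x#0))
    where
    x≉0 : ¬ x ≈ 0#
    x≉0 x≈0 = <-irrefl (trans (*-congʳ x≈0) (zeroˡ x)) xx<0

    x*x≮0 : ¬ (x < 0# ⊎ 0# < x)
    x*x≮0 (inj₁ x<0) = *-nonNeg 0≤-x 0≤-x (<-respˡ-≈ (sym (-x*-x≈x*x x)) xx<0)
      where
      0≤-x : 0# ≤ - x
      0≤-x = ≤-trans (≤-reflexive (sym -0#≈0#)) (neg-antitone-≤ (<⇒≤ x<0))
    x*x≮0 (inj₂ 0<x) = *-nonNeg (<⇒≤ 0<x) (<⇒≤ 0<x) xx<0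

  -- Integers inside the field.

  fromℕ-nonNeg : ∀ n → 0# ≤ fromℕ n
  fromℕ-nonNeg zero    = ≤-refl
  fromℕ-nonNeg (suc n) = <⇒≤ (0<fromℕ-suc n)

  1≤fromℕ-suc : ∀ n → 1# ≤ fromℕ (suc n)
  1≤fromℕ-suc n = ≤-trans (≤-reflexive (sym (+-identityʳ 1#)))
                          (+-mono-≤ ≤-refl (fromℕ-nonNeg n))

  -- Integrality enters here: a natural number is 0 or at least 1, whereas the inequality fails
  -- strictly between 0 and 1.
  fromℕ≤square : ∀ n → fromℕ n ≤ fromℕ n * fromℕ n
  fromℕ≤square zero    = ≤-reflexive (sym (zeroˡ 0#))
  fromℕ≤square (suc n) = ≤-trans (≤-reflexive (sym (*-identityˡ _)))
                                 (*-monoʳ-≤ (fromℕ-nonNeg (suc n)) (1≤fromℕ-suc n))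

  -- For z ≥ 0, both y z ≤ z and z ≤ z² hold. For z = -p < 0 the left side is at most 0, while the
  -- right side is p² - p ≥ 0.
  double-*≤square+ : ∀ z {y} → 0# ≤ y → y ≤ 1# →
                     y * fromℤ z + y * fromℤ z ≤ fromℤ z * fromℤ z + fromℤ z
  double-*≤square+ (+ n) {y} 0≤y y≤1 = begin
    y * q + y * q  ≤⟨ +-mono-≤ y*q≤q y*q≤q ⟩
    q + q          ≤⟨ +-monoˡ-≤ q (fromℕ≤square n) ⟩
    q * q + q      ∎
    where
    open ≤-Reasoning
    q = fromℕ n

    y*q≤q : y * q ≤ q
    y*q≤q = ≤-trans (*-monoʳ-≤ (fromℕ-nonNeg n) y≤1) (≤-reflexive (*-identityˡ q))
  double-*≤square+ -[1+ n ] {y} 0≤y y≤1 = begin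
    y * - p + y * - p  ≤⟨ +-mono-≤ y*-p≤0 y*-p≤0 ⟩
    0# + 0#            ≈⟨ +-identityˡ 0# ⟩
    0#                 ≤⟨ x≤y⇒0≤y-x (fromℕ≤square (suc n)) ⟩
    p * p - p          ≈⟨ +-congʳ (-x*-x≈x*x p) ⟨
    - p * - p - p      ∎
    where
    open ≤-Reasoning
    p = fromℕ (suc n)

    y*-p≤0 : y * - p ≤ 0#
    y*-p≤0 = begin
      y * - p    ≈⟨ -‿distribʳ-* y p ⟨
      - (y * p)  ≤⟨ neg-antitone-≤ (*-nonNeg 0≤y (fromℕ-nonNeg (suc n))) ⟩
      - 0#       ≈⟨ -0#≈0# ⟩
      0#         ∎

  1/suc-inverseˡ : ∀ n → 1/suc n * fromℕ (suc n) ≈ 1#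
  -- `reciprocal` inverts `fromℕ (suc n) - 0#`, so the subtracted zero has to be removed first.
  1/suc-inverseˡ n = trans (*-congˡ (sym (x-0≈x _)))
    (proj₁ (proj₂ (#⇒invertible
      (Equivalence.from #⇔<⊎> (inj₂ (0<fromℕ-suc n))))))

  -- Finite sums and minima.

  sum-mono-≤ : ∀ {n} {u v : Vector Carrier n} → (∀ i → u i ≤ v i) → sum u ≤ sum v
  sum-mono-≤ {zero}  u≤v = ≤-refl
  sum-mono-≤ {suc n} u≤v = +-mono-≤ (u≤v zero) (sum-mono-≤ (u≤v ∘ suc))

  sum-nonNeg : ∀ {n} {u : Vector Carrier n} → (∀ i → 0# ≤ u i) → 0# ≤ sum u
  sum-nonNeg {zero}  0≤u = ≤-refl
  sum-nonNeg {suc n} 0≤u = ≤-trans (≤-reflexive (sym (+-identityˡ 0#)))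
                                   (+-mono-≤ (0≤u zero) (sum-nonNeg (0≤u ∘ suc)))

  -- An iterated meet, since a least coordinate cannot be found by comparisons. Starting the fold at
  -- the head removes the need for a top element.
  minimum : ∀ {n} → Vector Carrier (suc n) → Carrier
  minimum v = foldr _∧_ (head v) (tail v)

  minimum≤ : ∀ {n} (v : Vector Carrier (suc n)) i → minimum v ≤ v i
  minimum≤ v = λ { zero → foldr≤base (tail v) ; (suc i) → foldr≤element (tail v) i }
    where
    foldr≤base : ∀ {n b} (u : Vector Carrier n) → foldr _∧_ b u ≤ b
    foldr≤base {zero}  u = ≤-refl
    foldr≤base {suc n} u = ≤-trans (x∧y≤y _ _) (foldr≤base (tail u))

    foldr≤element : ∀ {n b} (u : Vector Carrier n) i → foldr _∧_ b u ≤ u i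
    foldr≤element u zero    = x∧y≤x _ _
    foldr≤element u (suc i) = ≤-trans (x∧y≤y _ _) (foldr≤element (tail u) i)

  minimum-greatest : ∀ {n a} (v : Vector Carrier (suc n)) → (∀ i → a ≤ v i) → a ≤ minimum v
  minimum-greatest {a = a} v a≤v = ≤foldr (tail v) (a≤v zero) (a≤v ∘ suc)
    where
    ≤foldr : ∀ {n b} (u : Vector Carrier n) → a ≤ b → (∀ i → a ≤ u i) → a ≤ foldr _∧_ b u
    ≤foldr {zero}  u a≤b a≤u = a≤b
    ≤foldr {suc n} u a≤b a≤u = ∧-greatest (a≤u zero) (≤foldr (tail u) a≤b (a≤u ∘ suc))

module EuclideanProperties {c ℓ₁ ℓ₂} (ℝ : RealNumbers c ℓ₁ ℓ₂) where

  open RealNumbers ℝ hiding (zero)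
  open Euclidean ℝ
  open OrderedFieldProperties orderedField
  open SemiringSum semiring
  open SemiringSolver commutativeSemiring using (solve; _:+_; _:*_; _:=_)

  -- Square roots and the dot product.

  √-mono-≤ : ∀ {x y} → 0# ≤ x → 0# ≤ y → x ≤ y → √ x ≤ √ y
  √-mono-≤ 0≤x 0≤y x≤y = square-cancel-≤ (√-nonNeg 0≤y)
    (≤-trans (≤-reflexive (√-square 0≤x))
      (≤-trans x≤y (≤-reflexive (sym (√-square 0≤y)))))

  √-cancel-≤ : ∀ {x y} → 0# ≤ x → 0# ≤ y → √ x ≤ √ y → x ≤ y
  √-cancel-≤ 0≤x 0≤y √x≤√y =
    ≤-trans (≤-reflexive (sym (√-square 0≤x)))
      (≤-trans (square-mono-≤ (√-nonNeg 0≤x) √x≤√y) (≤-reflexive (√-square 0≤y)))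

  ·-nonNeg : ∀ {n} (x : ℝ^ n) → 0# ≤ x · x
  ·-nonNeg x = sum-nonNeg (λ i → square-nonNeg (x i))

  ·-comm : ∀ {n} (x y : ℝ^ n) → x · y ≈ y · x
  ·-comm x y = sum-cong-≋ (λ i → *-comm (x i) (y i))

  ·-congʳ : ∀ {n} {x y : ℝ^ n} (z : ℝ^ n) → x ≋ y → x · z ≈ y · z
  ·-congʳ z x≋y = sum-cong-≋ (λ i → *-congʳ (x≋y i))

  -- Adding `y · z` back reduces the claim to additivity of sums and cancellation in each
  -- coordinate.
  ·-distribʳ--ᵥ : ∀ {n} (z x y : ℝ^ n) → (x -ᵥ y) · z ≈ x · z - y · z
  ·-distribʳ--ᵥ z x y = x≈z//y ((x -ᵥ y) · z) (y · z) (x · z) (begin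
    (x -ᵥ y) · z + y · z
      ≈⟨ ∑-distrib-+ (zipWith _*_ (x -ᵥ y) z) (zipWith _*_ y z) ⟨
    sum (λ i → (x i - y i) * z i + y i * z i)
      ≈⟨ sum-cong-≋ (λ i → trans (sym (distribʳ (z i) _ _)) (*-congʳ (//-rightDividesˡ (y i) (x i)))) ⟩
    x · z                                   ∎)
    where open ≈-Reasoning

  replicate-· : ∀ {n} a (x : ℝ^ n) → replicate n a · x ≈ a * sum x
  replicate-· a x = sym (*-distribˡ-sum a x)

  ·-𝟏 : ∀ {n} (x : ℝ^ n) → x · 𝟏 ≈ sum x
  ·-𝟏 x = sum-cong-≋ (λ i → *-identityʳ (x i))

  -- Unit vectors and the roots of the lattice.

  identity-· : ∀ {n} i (x : ℝ^ n) → identity n i · x ≈ x i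
  identity-· {suc n} zero x = begin
    1# * x zero + replicate n 0# · tail x  ≈⟨ +-cong (*-identityˡ _) (replicate-· 0# (tail x)) ⟩
    x zero + 0# * sum (tail x)             ≈⟨ +-congˡ (zeroˡ _) ⟩
    x zero + 0#                            ≈⟨ +-identityʳ _ ⟩
    x zero                                 ∎
    where open ≈-Reasoning
  identity-· {suc n} (suc i) x = begin
    0# * x zero + identity n i · tail x  ≈⟨ +-cong (zeroˡ _) (identity-· i (tail x)) ⟩
    0# + x (suc i)                       ≈⟨ +-identityˡ _ ⟩
    x (suc i)                            ∎
    where open ≈-Reasoning

  0≤identity : ∀ {n} (i j : Fin n) → 0# ≤ identity n i j
  0≤identity i j with does (i ≟ j)
  ... | true  = <⇒≤ 0<1
  ... | false = ≤-refl

  -- These are the roots of A_n, together with 0 when i = j. The integer coordinates branch on the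
  -- same decisions as `identity`, so four Boolean cases settle integrality.
  identity-diff∈A : ∀ {n} (i j : Fin (suc n)) → (identity (suc n) i -ᵥ identity (suc n) j) ∈ A n
  identity-diff∈A {n} i j = ((λ k → indicator (does (i ≟ k)) ℤ.- indicator (does (j ≟ k)))
                            , (λ k → fromℤ-indicator (does (i ≟ k)) (does (j ≟ k))))
                          , (begin
    (identity (suc n) i -ᵥ identity (suc n) j) · 𝟏      ≈⟨ ·-distribʳ--ᵥ 𝟏 (identity _ i) (identity _ j) ⟩
    identity (suc n) i · 𝟏 - identity (suc n) j · 𝟏
      ≈⟨ +-cong (identity-· i 𝟏) (-‿cong (identity-· j 𝟏)) ⟩
    1# - 1#                                             ≈⟨ -‿inverseʳ 1# ⟩
    0#                                                  ∎)
    where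
    open ≈-Reasoning

    indicator : Bool → ℤ
    indicator b = if b then + 1 else + 0

    fromℤ-indicator : ∀ a b → (if a then 1# else 0#) - (if b then 1# else 0#)
                              ≈ fromℤ (indicator a ℤ.- indicator b)
    fromℤ-indicator true  true  = -‿inverseʳ 1#
    -- `fromℤ (+ 1)` unfolds to `1# + 0#`, so only `- 0#` has to be rewritten.
    fromℤ-indicator true  false = +-congˡ -0#≈0#
    fromℤ-indicator false true  = trans (+-identityˡ _) (-‿cong (sym (+-identityʳ 1#)))
    fromℤ-indicator false false = -‿inverseʳ 0#

  -- The projection onto H.

  -- Each row of `Ξ n` is by definition a unit vector minus a constant vector, so Ξ subtracts the
  -- mean from every coordinate. The later facts about Ξ rest on this form.
  Ξ-*ᵥ : ∀ n (y : ℝ^ (suc n)) → Ξ n *ᵥ y ≋ y -ᵥ replicate (suc n) (1/suc n * sum y)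
  Ξ-*ᵥ n y i = begin
    Ξ n i · y                                                     ≈⟨ ·-distribʳ--ᵥ y (identity _ i) (replicate _ _) ⟩
    identity (suc n) i · y - replicate (suc n) (1/suc n * (1# * 1#)) · y
      ≈⟨ +-cong (identity-· i y) (-‿cong (replicate-· _ y)) ⟩
    y i - 1/suc n * (1# * 1#) * sum y
      ≈⟨ +-congˡ (-‿cong (*-congʳ (trans (*-congˡ (*-identityˡ 1#)) (*-identityʳ _)))) ⟩
    y i - 1/suc n * sum y                                         ∎
    where open ≈-Reasoning

  sum--ᵥ-replicate : ∀ {n} (x : ℝ^ n) a → sum (x -ᵥ replicate n a) ≈ sum x - a * fromℕ n
  sum--ᵥ-replicate {n} x a = begin
    sum (x -ᵥ replicate n a)              ≈⟨ ·-𝟏 (x -ᵥ replicate n a) ⟨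
    (x -ᵥ replicate n a) · 𝟏              ≈⟨ ·-distribʳ--ᵥ 𝟏 x (replicate n a) ⟩
    x · 𝟏 - replicate n a · 𝟏
      ≈⟨ +-cong (·-𝟏 x) (-‿cong (trans (replicate-· {n} a 𝟏) (*-congˡ (sum-replicate n)))) ⟩
    sum x - a * fromℕ n                   ∎
    where open ≈-Reasoning

  1/suc-*-fromℕ : ∀ n a → 1/suc n * a * fromℕ (suc n) ≈ a
  1/suc-*-fromℕ n a = begin
    1/suc n * a * fromℕ (suc n)  ≈⟨ solve 3 (λ r b k → r :* b :* k := r :* k :* b) refl _ _ _ ⟩
    1/suc n * fromℕ (suc n) * a  ≈⟨ *-congʳ (1/suc-inverseˡ n) ⟩
    1# * a                       ≈⟨ *-identityˡ a ⟩
    a                            ∎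
    where open ≈-Reasoning

  Ξ-*ᵥ∈H : ∀ n y → Ξ n *ᵥ y ∈ H n
  Ξ-*ᵥ∈H n y = begin
    (Ξ n *ᵥ y) · 𝟏                                      ≈⟨ ·-𝟏 (Ξ n *ᵥ y) ⟩
    sum (Ξ n *ᵥ y)                                      ≈⟨ sum-cong-≋ (Ξ-*ᵥ n y) ⟩
    sum (y -ᵥ replicate (suc n) (1/suc n * sum y))      ≈⟨ sum--ᵥ-replicate y _ ⟩
    sum y - 1/suc n * sum y * fromℕ (suc n)             ≈⟨ +-congˡ (-‿cong (1/suc-*-fromℕ n (sum y))) ⟩
    sum y - sum y                                       ≈⟨ -‿inverseʳ (sum y) ⟩
    0#                                                  ∎
    where open ≈-Reasoning

  -- The subtracted vector is a multiple of `𝟏`, to which `q` is orthogonal. Pairings with lattice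
  -- vectors can thus be computed in the cube.
  Ξ-*ᵥ-· : ∀ n y q → q ∈ H n → (Ξ n *ᵥ y) · q ≈ y · q
  Ξ-*ᵥ-· n y q q∈H = begin
    (Ξ n *ᵥ y) · q                                      ≈⟨ ·-congʳ q (Ξ-*ᵥ n y) ⟩
    (y -ᵥ replicate (suc n) (1/suc n * sum y)) · q      ≈⟨ ·-distribʳ--ᵥ q y (replicate _ _) ⟩
    y · q - replicate (suc n) (1/suc n * sum y) · q     ≈⟨ +-congˡ (-‿cong (replicate-· _ q)) ⟩
    y · q - 1/suc n * sum y * sum q
      ≈⟨ +-congˡ (-‿cong (trans (*-congˡ (trans (sym (·-𝟏 q)) q∈H)) (zeroʳ _))) ⟩
    y · q - 0#                                          ≈⟨ +-congˡ -0#≈0# ⟩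
    y · q + 0#                                          ≈⟨ +-identityʳ _ ⟩
    y · q                                               ∎
    where open ≈-Reasoning

  Ξ-*ᵥ-translate : ∀ n x a → x ∈ H n → Ξ n *ᵥ (x -ᵥ replicate (suc n) a) ≋ x
  Ξ-*ᵥ-translate n x a x∈H i = begin
    (Ξ n *ᵥ (x -ᵥ replicate (suc n) a)) i                 ≈⟨ Ξ-*ᵥ n (x -ᵥ replicate (suc n) a) i ⟩
    x i - a - 1/suc n * sum (x -ᵥ replicate (suc n) a)    ≈⟨ +-congˡ (-‿cong mean≈-a) ⟩
    x i - a - - a                                         ≈⟨ //-rightDividesʳ (- a) (x i) ⟩
    x i                                                   ∎
    where
    open ≈-Reasoning

    -- The coordinates of `x` sum to 0, so the translate has mean `- a`; subtracting this mean
    -- undoes the translation.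
    mean≈-a : 1/suc n * sum (x -ᵥ replicate (suc n) a) ≈ - a
    mean≈-a = begin
      1/suc n * sum (x -ᵥ replicate (suc n) a)
        ≈⟨ *-congˡ (trans (sum--ᵥ-replicate x a) (+-congʳ (trans (sym (·-𝟏 x)) x∈H))) ⟩
      1/suc n * (0# - a * fromℕ (suc n))        ≈⟨ *-congˡ (+-identityˡ _) ⟩
      1/suc n * - (a * fromℕ (suc n))           ≈⟨ -‿distribʳ-* _ _ ⟨
      - (1/suc n * (a * fromℕ (suc n)))         ≈⟨ -‿cong (*-assoc _ _ _) ⟨
      - (1/suc n * a * fromℕ (suc n))           ≈⟨ -‿cong (1/suc-*-fromℕ n a) ⟩
      - a                                       ∎

  -- From distances to linear inequalities.

  ·-expand-diff : ∀ {n} (x q : ℝ^ n) →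
                  (x -ᵥ q) · (x -ᵥ q) + (x · q + x · q) ≈ x · x + q · q
  ·-expand-diff x q = begin
    (x -ᵥ q) · (x -ᵥ q) + (x · q + x · q)
      ≈⟨ +-congˡ (∑-distrib-+ (zipWith _*_ x q) (zipWith _*_ x q)) ⟨
    (x -ᵥ q) · (x -ᵥ q) + sum (λ i → x i * q i + x i * q i)
      ≈⟨ ∑-distrib-+ (zipWith _*_ (x -ᵥ q) (x -ᵥ q)) (λ i → x i * q i + x i * q i) ⟨
    sum (λ i → (x i - q i) * (x i - q i) + (x i * q i + x i * q i))
      ≈⟨ sum-cong-≋ (λ i → expand (//-rightDividesˡ (q i) (x i))) ⟩
    sum (λ i → x i * x i + q i * q i)
      ≈⟨ ∑-distrib-+ (zipWith _*_ x x) (zipWith _*_ q q) ⟩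
    x · x + q · q ∎
    where
    open ≈-Reasoning

    -- Keeping the difference `d` as a variable with d + b ≈ a leaves an identity without
    -- subtraction, which the semiring solver can prove.
    expand : ∀ {d a b} → d + b ≈ a → d * d + (a * b + a * b) ≈ a * a + b * b
    expand {d} {a} {b} d+b≈a = begin
      d * d + (a * b + a * b)
        ≈⟨ +-congˡ (+-cong (*-congʳ d+b≈a) (*-congʳ d+b≈a)) ⟨
      d * d + ((d + b) * b + (d + b) * b)
        ≈⟨ solve 2 (λ d b → d :* d :+ ((d :+ b) :* b :+ (d :+ b) :* b)
                         := (d :+ b) :* (d :+ b) :+ b :* b) refl d b ⟩
      (d + b) * (d + b) + b * b
        ≈⟨ +-congʳ (*-cong d+b≈a d+b≈a) ⟩
      a * a + b * b ∎

  double-·≤⇒closer : ∀ {n} (x q : ℝ^ n) → x · q + x · q ≤ q · q → ∥ x ∥ ≤ ∥ x -ᵥ q ∥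
  double-·≤⇒closer x q 2xq≤qq = √-mono-≤ (·-nonNeg x) (·-nonNeg (x -ᵥ q))
    (+-cancelʳ-≤ (q · q) (begin
      x · x + q · q                          ≈⟨ ·-expand-diff x q ⟨
      (x -ᵥ q) · (x -ᵥ q) + (x · q + x · q)  ≤⟨ +-mono-≤ ≤-refl 2xq≤qq ⟩
      (x -ᵥ q) · (x -ᵥ q) + q · q            ∎))
    where open ≤-Reasoning

  closer⇒double-·≤ : ∀ {n} (x q : ℝ^ n) → ∥ x ∥ ≤ ∥ x -ᵥ q ∥ → x · q + x · q ≤ q · q
  closer⇒double-·≤ x q x≤x-q = +-cancelʳ-≤ (x · x) (begin
    x · q + x · q + x · x                  ≈⟨ +-comm _ _ ⟩
    x · x + (x · q + x · q)
      ≤⟨ +-monoˡ-≤ _ (√-cancel-≤ (·-nonNeg x) (·-nonNeg (x -ᵥ q)) x≤x-q) ⟩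
    (x -ᵥ q) · (x -ᵥ q) + (x · q + x · q)  ≈⟨ ·-expand-diff x q ⟩
    x · x + q · q                          ≈⟨ +-comm _ _ ⟩
    q · q + x · x                          ∎)
    where open ≤-Reasoning

  -- From the Voronoi cell to the cube.

  ·-identity-diff : ∀ {n} (x : ℝ^ n) i j → x · (identity n i -ᵥ identity n j) ≈ x i - x j
  ·-identity-diff x i j = begin
    x · (identity _ i -ᵥ identity _ j)     ≈⟨ ·-comm x (identity _ i -ᵥ identity _ j) ⟩
    (identity _ i -ᵥ identity _ j) · x     ≈⟨ ·-distribʳ--ᵥ x (identity _ i) (identity _ j) ⟩
    identity _ i · x - identity _ j · x    ≈⟨ +-cong (identity-· i x) (-‿cong (identity-· j x)) ⟩
    x i - x j                              ∎
    where open ≈-Reasoning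

  -- The value is 2 for i ≠ j and 0 for i = j; an upper bound treats both cases at once.
  identity-diff-·≤2 : ∀ {n} (i j : Fin n) → let q = identity n i -ᵥ identity n j in q · q ≤ 1# + 1#
  identity-diff-·≤2 {n} i j = begin
    -- Pairing `q` with itself reads off two of its own coordinates.
    q · q            ≈⟨ ·-identity-diff q i j ⟩
    q i - q j        ≤⟨ +-mono-≤ qᵢ≤1 (≤-trans (neg-antitone-≤ -1≤qⱼ) (≤-reflexive (-‿involutive 1#))) ⟩
    1# + 1#          ∎
    where
    open ≤-Reasoning
    q = identity n i -ᵥ identity n j

    identity≤1 : ∀ k l → identity n k l ≤ 1#
    identity≤1 k l with does (k ≟ l)
    ... | true  = ≤-refl
    ... | false = <⇒≤ 0<1

    qᵢ≤1 : q i ≤ 1#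
    qᵢ≤1 = begin
      identity n i i - identity n j i
        ≤⟨ +-mono-≤ (identity≤1 i i) (neg-antitone-≤ (0≤identity j i)) ⟩
      1# - 0#  ≈⟨ +-congˡ -0#≈0# ⟩
      1# + 0#  ≈⟨ +-identityʳ 1# ⟩
      1#       ∎

    -1≤qⱼ : - 1# ≤ q j
    -1≤qⱼ = begin
      - 1#       ≈⟨ +-identityˡ _ ⟨
      0# - 1#    ≤⟨ +-mono-≤ (0≤identity i j) (neg-antitone-≤ (identity≤1 j j)) ⟩
      identity n i j - identity n j j ∎

  VoronoiCell⇒diff≤1 : ∀ n x → x ∈ VoronoiCell n → ∀ i j → x i - x j ≤ 1#
  VoronoiCell⇒diff≤1 n x (_ , closest) i j = x+x≤y+y⇒x≤y (begin
    (x i - x j) + (x i - x j)  ≈⟨ +-cong (·-identity-diff x i j) (·-identity-diff x i j) ⟨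
    x · q + x · q              ≤⟨ closer⇒double-·≤ x q (closest q (identity-diff∈A i j)) ⟩
    q · q                      ≤⟨ identity-diff-·≤2 i j ⟩
    1# + 1#                    ∎)
    where
    open ≤-Reasoning
    q = identity (suc n) i -ᵥ identity (suc n) j

  VoronoiCell⇒image : ∀ n {x} → x ∈ VoronoiCell n → x ∈ image (Ξ n) (UnitCube (suc n))
  VoronoiCell⇒image n {x} x∈V@(x∈H , _) =
      x -ᵥ replicate (suc n) (minimum x)
    , (λ i → x≤y⇒0≤y-x (minimum≤ x i)
           -- The bound is rearranged to `x i - 1# ≤ minimum x`. A meet is a greatest lower bound,
           -- so it suffices that `x i - 1# ≤ x j` for every `j`; no index attaining the minimum is
           -- needed.
           , x-z≤y⇒x-y≤z (minimum-greatest x λ j →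
               x-z≤y⇒x-y≤z (VoronoiCell⇒diff≤1 n x x∈V i j)))
    , (λ i → sym (Ξ-*ᵥ-translate n x (minimum x) x∈H i))

  -- From the cube to the Voronoi cell.

  -- The termwise bound 2 yᵢ qᵢ ≤ qᵢ² fails at yᵢ = qᵢ = 1. Adding qᵢ on the right repairs it, and
  -- these corrections sum to 0 because `q` lies in H.
  double-·≤ : ∀ n y q → y ∈ UnitCube (suc n) → q ∈ A n → y · q + y · q ≤ q · q
  double-·≤ n y q y∈C ((z , q≋z) , q∈H) = begin
    y · q + y · q                        ≈⟨ ∑-distrib-+ (zipWith _*_ y q) (zipWith _*_ y q) ⟨
    sum (λ i → y i * q i + y i * q i)    ≤⟨ sum-mono-≤ coordinate ⟩
    sum (λ i → q i * q i + q i)          ≈⟨ ∑-distrib-+ (zipWith _*_ q q) q ⟩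
    q · q + sum q                        ≈⟨ +-congˡ (trans (sym (·-𝟏 q)) q∈H) ⟩
    q · q + 0#                           ≈⟨ +-identityʳ _ ⟩
    q · q                                ∎
    where
    open ≤-Reasoning

    coordinate : ∀ i → y i * q i + y i * q i ≤ q i * q i + q i
    coordinate i = begin
      y i * q i + y i * q i                      ≈⟨ +-cong (*-congˡ (q≋z i)) (*-congˡ (q≋z i)) ⟩
      y i * fromℤ (z i) + y i * fromℤ (z i)      ≤⟨ double-*≤square+ (z i) (proj₁ (y∈C i)) (proj₂ (y∈C i)) ⟩
      fromℤ (z i) * fromℤ (z i) + fromℤ (z i)    ≈⟨ +-cong (*-cong (q≋z i) (q≋z i)) (q≋z i) ⟨
      q i * q i + q i                            ∎

  image⇒VoronoiCell : ∀ n {x} → x ∈ image (Ξ n) (UnitCube (suc n)) → x ∈ VoronoiCell n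
  image⇒VoronoiCell n {x} (y , y∈C , x≋Ξy) =
      trans (·-congʳ 𝟏 x≋Ξy) (Ξ-*ᵥ∈H n y)
    , λ q q∈A@(_ , q∈H) →
        let x·q≈y·q = trans (·-congʳ q x≋Ξy) (Ξ-*ᵥ-· n y q q∈H)
        in double-·≤⇒closer x q
             (≤-trans (≤-reflexive (+-cong x·q≈y·q x·q≈y·q)) (double-·≤ n y q y∈C q∈A))

lemma10 : ∀ {c ℓ₁ ℓ₂} (ℝ : RealNumbers c ℓ₁ ℓ₂) → let open Euclidean ℝ in
    (n : ℕ) → n ≥ 1 → VoronoiCell n ≐ image (Ξ n) (UnitCube (suc n))
lemma10 ℝ n _ = VoronoiCell⇒image n , image⇒VoronoiCell n
  where open EuclideanProperties ℝ
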